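{- For every integer $r\ge 0$: if there is a double cover of $\{0,1,2\}^r$ with $N$ boxes, then there is a double cover of $\{0,1,2\}^{r+3}$ with $6\cdot 2^r+3N$ boxes. Hence $$f(r+3)\le 6\cdot 2^r+3f(r)\qquad\text{for all } r\ge 0.$$
   Context: Write $[3]=\{0,1,2\}$. A proper sub-box of $[3]^d$ is a set $B=S_1\times\dots\times S_d$ with $\varnothing\neq S_i\subsetneq[3]$ for every $1\le i\le d$ (so each side $S_i$ has one or two elements). A double cover of $[3]^d$ is a finite multiset $\{B_1,\dots,B_m\}$ of proper sub-boxes such that every point of $[3]^d$ lies in exactly two of the $B_j$, counted with multiplicity; its size (number of boxes) is $m$. $f(d)$ denotes the minimum size of a double cover of $[3]^d$. For $d=0$, $[3]^0$ is a single point, which is itself the only proper sub-box (empty product). -}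

module Defs where

open import Data.Bool.Base using (true; false)
open import Data.Fin.Base using (Fin; zero; suc)
open import Data.Fin.Properties using () renaming (all? to allFin?)
open import Data.Fin.Subset using (Subset; Nonempty; _∈_; _⊂_; ⊤; ⁅_⁆)
open import Data.Fin.Subset.Properties using (_∈?_; x∈⁅x⁆; nonempty?; _⊂?_; anySubset?)
open import Data.Nat.Base using (ℕ; zero; suc; _+_; _≤_; z≤n; s≤s)
open import Data.Nat.Properties using () renaming (_≟_ to _≟ℕ_)
open import Data.Product.Base using (∃; ∃-syntax; _×_; _,_; proj₁)
open import Data.Vec.Base using (Vec; []; _∷_; _++_; map; count)
open import Data.Vec.Relation.Unary.All using (All; []; _∷_) renaming (all? to allVec?)
open import Data.Vec.Relation.Unary.All.Properties using (map⁺; ++⁺)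
open import Data.Vec.Relation.Binary.Pointwise.Inductive using (Pointwise; decidable)
open import Function.Base using (_∘_)
open import Level using (Level; 0ℓ)
open import Relation.Binary.PropositionalEquality using (_≡_; refl; trans; cong; cong₂)
open import Relation.Nullary.Decidable using (Dec; yes; no; does; map′; _×-dec_; from-yes)
open import Relation.Nullary.Negation using (contradiction)
open import Relation.Unary using (Pred; Decidable)

private
  variable
    d m n : ℕ
    ℓ : Level
    A : Set

Point : ℕ → Set
Point d = Vec (Fin 3) d

-- The vector S₁ ∷ … ∷ S_d ∷ [] stands for S₁ × … × S_d.  When the sides are
-- nonempty (as for proper boxes) the product determines them.
Box : ℕ → Set
Box d = Vec (Subset 3) d

ProperSide : Subset 3 → Set
ProperSide S = Nonempty S × S ⊂ ⊤

ProperBox : Box d → Set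
ProperBox = All ProperSide

infix 4 _∈ᴮ_ _∈ᴮ?_

_∈ᴮ_ : Point d → Box d → Set
_∈ᴮ_ = Pointwise _∈_

_∈ᴮ?_ : (p : Point d) (B : Box d) → Dec (p ∈ᴮ B)
_∈ᴮ?_ = decidable _∈?_

-- A multiset of m boxes is listed as a vector of length m: repetitions are
-- allowed, and the order is irrelevant to the two conditions.
IsDoubleCover : Vec (Box d) m → Set
IsDoubleCover {d} Bs = All ProperBox Bs × ((p : Point d) → count (p ∈ᴮ?_) Bs ≡ 2)

HasDoubleCover : ℕ → ℕ → Set
HasDoubleCover d m = ∃[ Bs ] IsDoubleCover {d} {m} Bs

IsLeast : Pred ℕ ℓ → Pred ℕ ℓ
IsLeast P n = P n × (∀ k → P k → n ≤ k)

-- The minimum size f d is obtained by finite search, which needs that the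
-- existence of a double cover of given size is decidable and that some double
-- cover exists.

private
  anyVec? : (∀ {P : Pred A 0ℓ} → Decidable P → Dec (∃ P)) →
            ∀ n {P : Pred (Vec A n) 0ℓ} → Decidable P → Dec (∃ P)
  anyVec? any? zero    P? = map′ ([] ,_) (λ { ([] , p) → p }) (P? [])
  anyVec? any? (suc n) P? =
    map′ (λ (x , xs , p) → x ∷ xs , p) (λ { (x ∷ xs , p) → x , xs , p })
         (any? λ x → anyVec? any? n λ xs → P? (x ∷ xs))

  allPoint? : ∀ d {P : Pred (Point d) 0ℓ} → Decidable P → Dec (∀ p → P p)
  allPoint? zero    P? = map′ (λ { p [] → p }) (λ f → f []) (P? [])
  allPoint? (suc d) P? =
    map′ (λ { f (x ∷ xs) → f x xs }) (λ f x xs → f (x ∷ xs))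
         (allFin? λ x → allPoint? d λ xs → P? (x ∷ xs))

  properSide? : Decidable ProperSide
  properSide? S = nonempty? S ×-dec (S ⊂? ⊤)

hasDoubleCover? : ∀ d m → Dec (HasDoubleCover d m)
hasDoubleCover? d m = anyVec? (anyVec? anySubset? d) m λ Bs →
  allVec? (allVec? properSide?) Bs ×-dec allPoint? d λ p → count (p ∈ᴮ?_) Bs ≟ℕ 2

least : {P : Pred ℕ ℓ} → Decidable P → ∀ n → P n → ∃ (IsLeast P)
least P? n pn with P? 0
... | yes p0 = 0 , p0 , λ _ _ → z≤n
least P? zero    pn | no ¬p0 = contradiction pn ¬p0
least P? (suc n) pn | no ¬p0 with least (P? ∘ suc) n pn
... | k , pk , k≤ = suc k , pk , λ where
  zero    p0 → contradiction p0 ¬p0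
  (suc j) pj → s≤s (k≤ j pj)

count-++ : {P : Pred A ℓ} (P? : Decidable P) (xs : Vec A m) (ys : Vec A n) →
           count P? (xs ++ ys) ≡ count P? xs + count P? ys
count-++ P? []       ys = refl
count-++ P? (x ∷ xs) ys with does (P? x)
... | true  = cong suc (count-++ P? xs ys)
... | false = count-++ P? xs ys

count-∷-∈ : ∀ {x S} → x ∈ S → (p : Point d) (Bs : Vec (Box d) m) →
            count ((x ∷ p) ∈ᴮ?_) (map (S ∷_) Bs) ≡ count (p ∈ᴮ?_) Bs
count-∷-∈ x∈S p [] = refl
count-∷-∈ {x = x} {S} x∈S p (B ∷ Bs) with x ∈? S
... | no x∉S = contradiction x∈S x∉S
... | yes _ with does (p ∈ᴮ? B)
...   | true  = cong suc (count-∷-∈ x∈S p Bs)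
...   | false = count-∷-∈ x∈S p Bs

count-∷-∉ : ∀ {x S} → does (x ∈? S) ≡ false → (p : Point d) (Bs : Vec (Box d) m) →
            count ((x ∷ p) ∈ᴮ?_) (map (S ∷_) Bs) ≡ 0
count-∷-∉ x∉S p [] = refl
count-∷-∉ x∉S p (B ∷ Bs) rewrite x∉S = count-∷-∉ x∉S p Bs

-- Every point, taken twice as a product of singletons.
someDoubleCover : ∀ d → ∃ (HasDoubleCover d)
someDoubleCover zero    = 2 , [] ∷ [] ∷ [] , [] ∷ [] ∷ [] , λ { [] → refl }
someDoubleCover (suc d) with someDoubleCover d
... | m , Bs , proper , covers =
    _ , slab 0F ++ (slab 1F ++ slab 2F)
  , ++⁺ (slab-proper 0F) (++⁺ (slab-proper 1F) (slab-proper 2F))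
  , λ { (x ∷ p) → trans (trans (count-++ _ (slab 0F) _)
                               (cong (count ((x ∷ p) ∈ᴮ?_) (slab 0F) +_) (count-++ _ (slab 1F) _)))
                        (covered x p) }
  where
  0F 1F 2F : Fin 3
  0F = zero
  1F = suc zero
  2F = suc (suc zero)

  slab : Fin 3 → Vec (Box (suc d)) m
  slab i = map (⁅ i ⁆ ∷_) Bs

  singleton-proper : ∀ i → ProperSide ⁅ i ⁆
  singleton-proper = from-yes (allFin? λ i → properSide? ⁅ i ⁆)

  slab-proper : ∀ i → All ProperBox (slab i)
  slab-proper i = map⁺ (go proper)
    where
    go : ∀ {k} {Cs : Vec (Box d) k} → All ProperBox Cs → All (ProperBox ∘ (⁅ i ⁆ ∷_)) Cs
    go []       = []
    go (q ∷ qs) = (singleton-proper i ∷ q) ∷ go qs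

  on : ∀ i p → count ((i ∷ p) ∈ᴮ?_) (slab i) ≡ 2
  on i p = trans (count-∷-∈ (x∈⁅x⁆ i) p Bs) (covers p)

  covered : ∀ x p → let c = λ i → count ((x ∷ p) ∈ᴮ?_) (slab i) in
            c 0F + (c 1F + c 2F) ≡ 2
  covered zero p =
    cong₂ _+_ (on 0F p) (cong₂ _+_ (count-∷-∉ refl p Bs) (count-∷-∉ refl p Bs))
  covered (suc zero) p =
    cong₂ _+_ (count-∷-∉ refl p Bs) (cong₂ _+_ (on 1F p) (count-∷-∉ refl p Bs))
  covered (suc (suc zero)) p =
    cong₂ _+_ (count-∷-∉ refl p Bs) (cong₂ _+_ (count-∷-∉ refl p Bs) (on 2F p))

minimumSize : ∀ d → ∃ (IsLeast (HasDoubleCover d))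
minimumSize d = let m , cover = someDoubleCover d in least (hasDoubleCover? d) m cover

f : ℕ → ℕ
f d = proj₁ (minimumSize d)

{-# OPTIONS --safe #-}
-- For a permutation σ of {0,1,2} let D σ be the box of the x ∈ [3]³ with x i ≠ σ i
-- for every i.  A diagonal point lies in no D σ, and any other point lies in exactly
-- two.  So the three diagonal points times a double cover of [3]ʳ, together with the
-- six D σ times a partition of [3]ʳ into 2ʳ proper boxes, doubly cover [3]³⁺ʳ.
module Submission where

open import Defs
open import Data.Bool.Base using (true; false; _∧_)
open import Data.Bool.Properties using (∧-assoc)
open import Data.Fin.Base using (Fin)
open import Data.Fin.Patterns using (0F; 1F; 2F)
open import Data.Fin.Properties using () renaming (all? to allFin?)
open import Data.Fin.Subset using (⁅_⁆; ∁)
open import Data.Fin.Subset.Properties using (_∈?_; nonempty?; _⊂?_)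
open import Data.Nat.Base using (ℕ; suc; _+_; _*_; _^_; _≤_)
open import Data.Nat.Properties using (+-comm; _≟_)
open import Data.Product.Base using (_×_; _,_; proj₁; proj₂)
open import Data.Vec.Base using (Vec; []; _∷_; _++_; _⊛*_; allFin; count; map; replicate)
open import Data.Vec.Relation.Unary.All as All using (All; []; _∷_)
open import Data.Vec.Relation.Unary.All.Properties using (map⁺; ++⁺)
open import Function.Base using (_∘_)
open import Relation.Binary.PropositionalEquality
  using (_≡_; refl; sym; trans; cong; cong₂; subst; module ≡-Reasoning)
open import Relation.Nullary.Decidable using (does; _×-dec_; from-yes)
open import Relation.Unary using (Decidable)

private
  variable
    d k m n : ℕ

IsCover : ℕ → Vec (Box d) m → Set
IsCover {d} k Bs = All ProperBox Bs × ((p : Point d) → count (p ∈ᴮ?_) Bs ≡ k)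

infixr 6 _⊠_

-- `⊛*` gives this list the length `m * n` by definition, so the sizes of the covers built below
-- need no arithmetic.
_⊠_ : Vec (Box k) m → Vec (Box d) n → Vec (Box (k + d)) (m * n)
As ⊠ Bs = map _++_ As ⊛* Bs

⊠-proper : {As : Vec (Box k) m} {Bs : Vec (Box d) n} →
           All ProperBox As → All ProperBox Bs → All ProperBox (As ⊠ Bs)
⊠-proper []       qs = []
⊠-proper (p ∷ ps) qs = ++⁺ (map⁺ (All.map (++⁺ p) qs)) (⊠-proper ps qs)

-- `count` branches only on `does`, and `decidable` computes it coordinatewise as a conjunction, so
-- only reassociation is left.
does-∈ᴮ-++ : (x : Point k) (p : Point d) (A : Box k) (B : Box d) →
             does (x ++ p ∈ᴮ? A ++ B) ≡ does (x ∈ᴮ? A) ∧ does (p ∈ᴮ? B)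
does-∈ᴮ-++ []      p []      B = refl
does-∈ᴮ-++ (i ∷ x) p (S ∷ A) B =
  trans (cong (does (i ∈? S) ∧_) (does-∈ᴮ-++ x p A B)) (sym (∧-assoc (does (i ∈? S)) _ _))

-- The count over `A ∷ []` is the indicator of `x` in `A`: as 1 it keeps the count over `Bs`, as 0
-- it kills it.
count-map-++ : (x : Point k) (p : Point d) (A : Box k) (Bs : Vec (Box d) n) →
               count (x ++ p ∈ᴮ?_) (map (A ++_) Bs) ≡ count (x ∈ᴮ?_) (A ∷ []) * count (p ∈ᴮ?_) Bs
count-map-++ x p A [] with does (x ∈ᴮ? A)
... | true  = refl
... | false = refl
count-map-++ x p A (B ∷ Bs)
  rewrite does-∈ᴮ-++ x p A B with does (x ∈ᴮ? A) | does (p ∈ᴮ? B) | count-map-++ x p A Bs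
... | true  | true  | eq = cong suc eq
... | true  | false | eq = eq
... | false | _     | eq = eq

count-⊠ : (x : Point k) (p : Point d) (As : Vec (Box k) m) (Bs : Vec (Box d) n) →
          count (x ++ p ∈ᴮ?_) (As ⊠ Bs) ≡ count (x ∈ᴮ?_) As * count (p ∈ᴮ?_) Bs
count-⊠ x p []       Bs = refl
count-⊠ x p (A ∷ As) Bs
  rewrite count-++ (x ++ p ∈ᴮ?_) (map (A ++_) Bs) (As ⊠ Bs)
        | count-map-++ x p A Bs | count-⊠ x p As Bs
  with does (x ∈ᴮ? A)
-- The contribution of `A` is `1 * b`, which computes to `b + 0`.
... | true  = cong (_+ count (x ∈ᴮ?_) As * b) (+-comm b 0)
  where b = count (p ∈ᴮ?_) Bs
... | false = refl

allProper? : Decidable (All (ProperBox {d}) {m})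
allProper? = All.all? (All.all? λ S → nonempty? S ×-dec (S ⊂? _))

-- A proper side has at most two elements, so two sides are the fewest that can partition a
-- coordinate.
halves : Vec (Box 1) 2
halves = (⁅ 0F ⁆ ∷ []) ∷ (∁ ⁅ 0F ⁆ ∷ []) ∷ []

partition : ∀ d → Vec (Box d) (2 ^ d)
partition 0       = [] ∷ []
partition (suc d) = halves ⊠ partition d

partition-isCover : ∀ d → IsCover 1 (partition d)
partition-isCover 0       = [] ∷ [] , λ { [] → refl }
partition-isCover (suc d) =
  let proper , covers = partition-isCover d in
  ⊠-proper (from-yes (allProper? halves)) proper ,
  λ { (i ∷ p) → trans (count-⊠ (i ∷ []) p halves (partition d)) (cong₂ _*_ (halved i) (covers p)) }
  where
  halved : ∀ i → count (i ∷ [] ∈ᴮ?_) halves ≡ 1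
  halved = from-yes (allFin? λ i → count (i ∷ [] ∈ᴮ?_) halves ≟ 1)

diagonal : Vec (Box 3) 3
diagonal = map (replicate 3 ∘ ⁅_⁆) (allFin 3)

permutations : Vec (Point 3) 6
permutations = (0F ∷ 1F ∷ 2F ∷ []) ∷ (0F ∷ 2F ∷ 1F ∷ []) ∷ (1F ∷ 0F ∷ 2F ∷ [])
             ∷ (1F ∷ 2F ∷ 0F ∷ []) ∷ (2F ∷ 0F ∷ 1F ∷ []) ∷ (2F ∷ 1F ∷ 0F ∷ []) ∷ []

avoiding : Vec (Box 3) 6
avoiding = map (map (∁ ∘ ⁅_⁆)) permutations

-- The weights 1 and 2 are the multiplicities of the covers of the remaining coordinates. A
-- permutation takes every value, so it cannot avoid a constant point. For a point `a, a, b` with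
-- `a` and `b` distinct, `a` must be its third value and the other two are free; a point with
-- distinct coordinates is avoided by the two nontrivial cyclic shifts. The proof checks all 27
-- points.
avoiding+2diagonal : (i j k : Fin 3) → let x = i ∷ j ∷ k ∷ [] in
                     count (x ∈ᴮ?_) avoiding * 1 + count (x ∈ᴮ?_) diagonal * 2 ≡ 2
avoiding+2diagonal = from-yes (allFin? λ i → allFin? λ j → allFin? λ k →
  let x = i ∷ j ∷ k ∷ [] in
  count (x ∈ᴮ?_) avoiding * 1 + count (x ∈ᴮ?_) diagonal * 2 ≟ 2)

-- With the new coordinates in front, `i ∷ j ∷ k ∷ p` is `x ++ p` by computation.
doubleCover-3+ : HasDoubleCover d n → HasDoubleCover (3 + d) (6 * 2 ^ d + 3 * n)
doubleCover-3+ {d} (Bs , proper , covers) =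
  avoiding ⊠ partition d ++ diagonal ⊠ Bs ,
  ++⁺ (⊠-proper (from-yes (allProper? avoiding)) (proj₁ (partition-isCover d)))
      (⊠-proper (from-yes (allProper? diagonal)) proper) ,
  λ { (i ∷ j ∷ k ∷ p) → covered i j k p }
  where
  covered : ∀ i j k p → count (i ∷ j ∷ k ∷ p ∈ᴮ?_) (avoiding ⊠ partition d ++ diagonal ⊠ Bs) ≡ 2
  covered i j k p = begin
    count (x ++ p ∈ᴮ?_) (avoiding ⊠ partition d ++ diagonal ⊠ Bs)
      ≡⟨ count-++ _ (avoiding ⊠ partition d) (diagonal ⊠ Bs) ⟩
    count (x ++ p ∈ᴮ?_) (avoiding ⊠ partition d) + count (x ++ p ∈ᴮ?_) (diagonal ⊠ Bs)
      ≡⟨ cong₂ _+_ (count-⊠ x p avoiding (partition d)) (count-⊠ x p diagonal Bs) ⟩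
    a * count (p ∈ᴮ?_) (partition d) + c * count (p ∈ᴮ?_) Bs
      ≡⟨ cong₂ (λ s t → a * s + c * t) (proj₂ (partition-isCover d) p) (covers p) ⟩
    a * 1 + c * 2
      ≡⟨ avoiding+2diagonal i j k ⟩
    2 ∎
    where
    open ≡-Reasoning
    x = i ∷ j ∷ k ∷ []
    a = count (x ∈ᴮ?_) avoiding
    c = count (x ∈ᴮ?_) diagonal

doubleCover-+3 : ∀ r N → HasDoubleCover r N → HasDoubleCover (r + 3) (6 * 2 ^ r + 3 * N)
doubleCover-+3 r N = subst (λ d → HasDoubleCover d (6 * 2 ^ r + 3 * N)) (+-comm 3 r) ∘ doubleCover-3+

theorem7p1 : ((r N : ℕ) → HasDoubleCover r N → HasDoubleCover (r + 3) (6 * 2 ^ r + 3 * N))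
    × ((r : ℕ) → f (r + 3) ≤ 6 * 2 ^ r + 3 * f r)
theorem7p1 = doubleCover-+3 , λ r →
  -- Minimality in dimension `r + 3` is applied to the cover built from one of size `f r`.
  proj₂ (proj₂ (minimumSize (r + 3))) _ (doubleCover-+3 r (f r) (proj₁ (proj₂ (minimumSize r))))
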